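{- For every deterministic online algorithm with predictions for interval selection with unit weights in the model of irrevocable decisions, there exist an instance with unit weights (with an arrival order and a fixed optimal solution) and predictions, with total error $\eta$, such that $ALG = OPT - \eta$.
   Context: Interval selection: an instance is a finite nonempty set $\mathcal{I}$ of intervals $[s_i,f_i)$ on the real line, $s_i<f_i$, arriving one at a time in an arbitrary (adversarial) order. Two intervals conflict if they intersect. Each interval $I$ has a weight $w(I)$; unit weights means $w(I)=1$ for all $I$. The goal is to output a set of pairwise disjoint intervals of maximum total weight. $OPT$ denotes the maximum total weight of a set of pairwise disjoint intervals of the instance, and $ALG$ the total weight of the algorithm's final solution. Irrevocable decisions: upon each arrival, the algorithm, knowing only the intervals and predictions revealed so far, must accept or reject the interval; both decisions are final, and the accepted intervals must be pairwise disjoint. Predictions: each interval $I$ arrives together with a bit $Prd(I)\in\{0,1\}$; $Prd(I)=1$ means $I$ is predicted to belong to a fixed optimal solution $O$, and $Prd(I)=0$ means it is predicted not to belong to $O$. The prediction of $I$ is accurate if ($Prd(I)=1 \iff I\in O$). Error (with respect to $O$): $\eta(I)=0$ if the prediction of $I$ is accurate; $\eta(I)=w(I)$ if $I\in O$ and $Prd(I)=0$; $\eta(I)=\sum_{J\in\mathcal{C}}w(J)-w(I)$ if $I\notin O$ and $Prd(I)=1$, where $\mathcal{C}$ is the set of intervals of $O$ that conflict with $I$. The total error is $\eta=\sum_{I\in\mathcal{I}}\eta(I)$. -}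

module Defs where

open import Level using (0ℓ)
open import Data.Bool using (Bool; true; false; if_then_else_)
open import Data.Fin using (Fin; toℕ)
open import Data.Fin.Subset using (Subset; _∈_; _∩_)
open import Data.Integer using (ℤ; 0ℤ; 1ℤ; _-_; _≤_; +-0-rawMonoid)
open import Data.List as List using (List)
open import Data.Nat using (ℕ; suc)
open import Data.Product using (∃; ∃-syntax; _×_; _,_)
open import Data.Rational as ℚ using (ℚ)
open import Data.Sum using (_⊎_)
open import Data.Vec as Vec using ()
open import Function.Bundles using (_⇔_)
open import Relation.Binary.PropositionalEquality using (_≢_)
open import Relation.Nullary using (¬_; Dec; does)
open import Relation.Unary using (Pred)
open import Algebra.Definitions.RawMonoid +-0-rawMonoid using (sum)

-- Two-sided Dedekind cuts: L q means q < x, and U q means x < q.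
record ℝ : Set₁ where
  field
    L U         : Pred ℚ 0ℓ
    L-inhabited : ∃ L
    U-inhabited : ∃ U
    L-rounded   : ∀ q → L q ⇔ (∃[ r ] (q ℚ.< r × L r))
    U-rounded   : ∀ q → U q ⇔ (∃[ r ] (r ℚ.< q × U r))
    disjoint    : ∀ q → ¬ (L q × U q)
    located     : ∀ {q r} → q ℚ.< r → L q ⊎ U r

infix 4 _<ᴿ_ _≤ᴿ_ _≈ᴿ_

_<ᴿ_ : ℝ → ℝ → Set
x <ᴿ y = ∃[ q ] (ℝ.U x q × ℝ.L y q)

_≤ᴿ_ : ℝ → ℝ → Set
x ≤ᴿ y = ¬ (y <ᴿ x)

-- Equality of reals; propositional equality would compare representations.
_≈ᴿ_ : ℝ → ℝ → Set
x ≈ᴿ y = x ≤ᴿ y × y ≤ᴿ x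

record Interval : Set₁ where
  constructor mkInterval
  field
    start  : ℝ
    finish : ℝ
    start<finish : start <ᴿ finish

open Interval

infix 4 _∈ᴵ_ _≈ᴵ_

_∈ᴵ_ : ℝ → Interval → Set
x ∈ᴵ I = start I ≤ᴿ x × x <ᴿ finish I

_≈ᴵ_ : Interval → Interval → Set
I ≈ᴵ J = start I ≈ᴿ start J × finish I ≈ᴿ finish J

Conflict : Interval → Interval → Set₁
Conflict I J = ∃[ x ] (x ∈ᴵ I × x ∈ᴵ J)

-- Intervals are numbered in order of arrival. The order on ℝ is not decidable
-- constructively, so an instance carries the decision of which of its intervals
-- conflict, which is needed to sum over the conflicting ones. The sums depend
-- only on the yes/no answers, hence not on the choice of this field.
record Instance : Set₁ where
  field
    size-1    : ℕ
  size : ℕ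
  size = suc size-1
  field
    interval  : Fin size → Interval
    distinct  : ∀ {i j} → i ≢ j → ¬ (interval i ≈ᴵ interval j)
    conflict? : ∀ i j → Dec (Conflict (interval i) (interval j))

module _ (𝓘 : Instance) where
  open Instance 𝓘

  Predictions : Set
  Predictions = Fin size → Bool

  Weights : Set
  Weights = Fin size → ℤ

  unit : Weights
  unit _ = 1ℤ

  Independent : Subset size → Set₁
  Independent S =
    ∀ {i j} → i ∈ S → j ∈ S → i ≢ j → ¬ Conflict (interval i) (interval j)

  weight : Weights → Subset size → ℤ
  weight w S = sum (λ i → if Vec.lookup S i then w i else 0ℤ)

  IsOptimal : Weights → Subset size → Set₁
  IsOptimal w O = Independent O × (∀ S → Independent S → weight w S ≤ weight w O)

  conflicting : Fin size → Subset size
  conflicting i = Vec.tabulate (λ j → does (conflict? i j))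

  error : Weights → Subset size → Predictions → Fin size → ℤ
  error w O Prd i with Vec.lookup O i | Prd i
  ... | true  | true  = 0ℤ
  ... | false | false = 0ℤ
  ... | true  | false = w i
  ... | false | true  = weight w (O ∩ conflicting i) - w i

  totalError : Weights → Subset size → Predictions → ℤ
  totalError w O Prd = sum (error w O Prd)

-- A deterministic online rule maps the earlier arrivals (oldest first) and the
-- current one to accept (true) or reject (false). Its own earlier decisions are
-- determined by the earlier arrivals.
Arrival : Set₁
Arrival = Interval × Bool

Rule : Set₁
Rule = List Arrival → Arrival → Bool

accepted : Rule → (𝓘 : Instance) → Predictions 𝓘 → Subset (Instance.size 𝓘)
accepted decide 𝓘 Prd =
  Vec.tabulate (λ i → decide (List.take (toℕ i) (List.tabulate arrival)) (arrival i))
  where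
  arrival : Fin (Instance.size 𝓘) → Arrival
  arrival i = Instance.interval 𝓘 i , Prd i

record Algorithm : Set₁ where
  field
    decide   : Rule
    feasible : ∀ 𝓘 Prd → Independent 𝓘 (accepted decide 𝓘 Prd)

ALG : Algorithm → (𝓘 : Instance) → Weights 𝓘 → Predictions 𝓘 → ℤ
ALG A 𝓘 w Prd = weight 𝓘 w (accepted (Algorithm.decide A) 𝓘 Prd)

{-# OPTIONS --safe #-}
-- All intervals are of the form [0, k), so any two conflict and OPT = 1. Offer
-- [0, 1) with prediction 0. If it is rejected, the instance ends there: O is
-- that interval, ALG = 0 and η = 1. If it is accepted, [0, 2) follows with
-- prediction 1: O is the second interval, which the algorithm can no longer
-- take, so that ALG = 1 and η = 0.
module Submission where

open import Defs
open import Data.Bool using (true; false)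
open import Data.Fin using (zero; suc; toℕ)
open import Data.Fin.Properties using (toℕ-injective)
open import Data.Fin.Subset using (Subset)
open import Data.Integer as ℤ using (+_; 1ℤ; _-_; +≤+)
open import Data.List using ([]; _∷_)
open import Data.Nat using (ℕ; suc; z≤n; s≤s)
import Data.Nat.Coprimality as Coprime
open import Data.Product using (Σ-syntax; _×_; _,_)
open import Data.Rational using (ℚ; mkℚ; 0ℚ; 1ℚ; _+_; -_; _<_; _≤_)
open import Data.Rational.Properties
  using (<-dense; <-trans; <-asym; ≤-<-trans; _<?_; ≮⇒≥; ≤-antisym;
         positive⁻¹; negative⁻¹; +-monoʳ-<; +-identityʳ)
open import Data.Sum using (inj₁; inj₂)
open import Data.Vec as Vec using ([]; _∷_; here; there)
open import Function using (_∘_)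
open import Function.Bundles using (mk⇔)
open import Relation.Binary.PropositionalEquality
  using (_≡_; refl; cong; cong₂; subst)
open import Relation.Nullary using (yes; no; contradiction)

fromℚ : ℚ → ℝ
fromℚ p = record
  { L           = _< p
  ; U           = p <_
  ; L-inhabited = p + - 1ℚ , subst (p + - 1ℚ <_) (+-identityʳ p) (+-monoʳ-< p (negative⁻¹ (- 1ℚ)))
  ; U-inhabited = p + 1ℚ , subst (_< p + 1ℚ) (+-identityʳ p) (+-monoʳ-< p (positive⁻¹ 1ℚ))
  ; L-rounded   = λ _ → mk⇔ <-dense (λ (_ , q<r , r<p) → <-trans q<r r<p)
  ; U-rounded   = λ _ → mk⇔ (λ p<q → let r , p<r , r<q = <-dense p<q in r , r<q , p<r)
                            (λ (_ , r<q , p<r) → <-trans p<r r<q)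
  ; disjoint    = λ _ (q<p , p<q) → <-asym q<p p<q
  ; located     = located
  }
  where
  located : ∀ {q r} → q < r → _
  located {q} q<r with q <? p
  ... | yes q<p = inj₁ q<p
  ... | no  q≮p = inj₂ (≤-<-trans (≮⇒≥ q≮p) q<r)

≤ᴿ-refl : ∀ {x} → x ≤ᴿ x
≤ᴿ-refl {x} (q , x<q , q<x) = ℝ.disjoint x q (q<x , x<q)

-- If `q < p`, density gives a rational strictly between them, which is exactly a witness of
-- `fromℚ q <ᴿ fromℚ p`.
fromℚ-cancel-≤ : ∀ {p q} → fromℚ p ≤ᴿ fromℚ q → p ≤ q
fromℚ-cancel-≤ p≤q = ≮⇒≥ (p≤q ∘ <-dense)

fromℚ-injective : ∀ {p q} → fromℚ p ≈ᴿ fromℚ q → p ≡ q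
fromℚ-injective (p≤q , q≤p) = ≤-antisym (fromℚ-cancel-≤ p≤q) (fromℚ-cancel-≤ q≤p)

-- The fraction (k+1)/1, given directly in lowest terms so that injectivity follows by unifying
-- constructors.
1+ : ℕ → ℚ
1+ k = mkℚ (+ suc k) 0 (Coprime.sym (Coprime.1-coprimeTo (suc k)))

1+-injective : ∀ {k l} → 1+ k ≡ 1+ l → k ≡ l
1+-injective refl = refl

-- Opaque so that comparing arrivals never normalises the rational arithmetic in the cuts.
opaque
  [0,1+_⟩ : ℕ → Interval
  [0,1+ k ⟩ = mkInterval (fromℚ 0ℚ) (fromℚ (1+ k)) (<-dense (positive⁻¹ (1+ k)))

  [0,1+⟩-injective : ∀ {k l} → [0,1+ k ⟩ ≈ᴵ [0,1+ l ⟩ → k ≡ l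
  [0,1+⟩-injective (_ , f≈f) = 1+-injective (fromℚ-injective f≈f)

  -- The common left end point 0 belongs to every interval.
  all-conflict : ∀ k l → Conflict [0,1+ k ⟩ [0,1+ l ⟩
  all-conflict k l = fromℚ 0ℚ , 0∈ k , 0∈ l
    where
    0∈ : ∀ k → fromℚ 0ℚ ∈ᴵ [0,1+ k ⟩
    0∈ k = ≤ᴿ-refl {fromℚ 0ℚ} , Interval.start<finish [0,1+ k ⟩

-- There are n+1 arrivals, so `nested 0` is a prefix of `nested 1`: with equal predictions, a rule
-- decides the first arrival alike in both.
nested : ℕ → Instance
nested n = record
  { size-1    = n
  ; interval  = λ i → [0,1+ toℕ i ⟩
  ; distinct  = λ i≢j I≈J → i≢j (toℕ-injective ([0,1+⟩-injective I≈J))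
  ; conflict? = λ i j → yes (all-conflict (toℕ i) (toℕ j))
  }

nested₀-optimal : IsOptimal (nested 0) (unit (nested 0)) (true ∷ [])
nested₀-optimal = independent , maximal
  where
  independent : Independent (nested 0) (true ∷ [])
  independent {zero} {zero} _ _ i≢j = contradiction refl i≢j

  maximal : ∀ S → Independent (nested 0) S → weight (nested 0) (unit (nested 0)) S ℤ.≤ 1ℤ
  maximal (true  ∷ []) _ = +≤+ (s≤s z≤n)
  maximal (false ∷ []) _ = +≤+ z≤n

-- Used twice: to bound the weight of any independent set, and to force the algorithm's second
-- decision.
nested₁-first-excludes-second : ∀ a b → Independent (nested 1) (a ∷ b ∷ []) → a ≡ true → b ≡ false
nested₁-first-excludes-second _    false _   _ = refl
nested₁-first-excludes-second true true  ind _ =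
  contradiction (all-conflict 0 1) (ind {zero} {suc zero} here (there here) λ ())

nested₁-optimal : IsOptimal (nested 1) (unit (nested 1)) (false ∷ true ∷ [])
nested₁-optimal = independent , maximal
  where
  independent : Independent (nested 1) (false ∷ true ∷ [])
  independent {suc zero} {suc zero} _ _ i≢j = contradiction refl i≢j

  maximal : ∀ S → Independent (nested 1) S → weight (nested 1) (unit (nested 1)) S ℤ.≤ 1ℤ
  maximal (false ∷ false ∷ []) _ = +≤+ z≤n
  maximal (false ∷ true  ∷ []) _ = +≤+ (s≤s z≤n)
  maximal (true  ∷ b     ∷ []) ind with refl ← nested₁-first-excludes-second true b ind refl = +≤+ (s≤s z≤n)

theorem3p3 : (A : Algorithm) →
    Σ[ 𝓘 ∈ Instance ] Σ[ O ∈ Subset (Instance.size 𝓘) ] Σ[ Prd ∈ Predictions 𝓘 ]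
    (IsOptimal 𝓘 (unit 𝓘) O ×
    ALG A 𝓘 (unit 𝓘) Prd ≡ weight 𝓘 (unit 𝓘) O - totalError 𝓘 (unit 𝓘) O Prd)
theorem3p3 A with Algorithm.decide A [] ([0,1+ 0 ⟩ , false) in first
... | false =
  nested 0 , true ∷ [] , Vec.lookup (false ∷ []) , nested₀-optimal ,
  -- Once the decision is replaced by `false`, both sides compute to 0, the right one as 1 - 1.
  cong (λ b → weight (nested 0) (unit (nested 0)) (b ∷ [])) first
... | true =
  nested 1 , false ∷ true ∷ [] , Prd , nested₁-optimal ,
  -- Both predictions are accurate, so the right side computes to 1 - 0, the weight of
  -- `true ∷ false ∷ []`.
  cong (weight (nested 1) (unit (nested 1))) (cong₂ (λ b c → b ∷ c ∷ []) first second-rejected)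
  where
  Prd : Predictions (nested 1)
  Prd = Vec.lookup (false ∷ true ∷ [])

  second-rejected : Algorithm.decide A (([0,1+ 0 ⟩ , false) ∷ []) ([0,1+ 1 ⟩ , true) ≡ false
  second-rejected = nested₁-first-excludes-second _ _ (Algorithm.feasible A (nested 1) Prd) first
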